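{- Let $D = K_4 - e$ be the diamond. For every $n$ with $4 \leq n \leq 10$, $rb(K_n,D) = ext(n,\{C_3,C_4\}) + 2$.
   Context: For a graph $H$ and an integer $n$, the rainbow number $rb(K_n,H)$ is the minimum number $m$ such that every edge-colouring of $K_n$ using at least $m$ colours contains a rainbow copy of $H$ (a subgraph isomorphic to $H$ whose edges all have distinct colours). For a family $\mathcal{H}$ of graphs, $ext(n,\mathcal{H})$ is the maximum number of edges in a graph on $n$ vertices containing no member of $\mathcal{H}$ as a subgraph. $C_k$ denotes the cycle on $k$ vertices. -}

module Defs where

open import Data.Nat using (ℕ; _≤_; _<_; _+_; _<ᵇ_)
open import Data.Fin using (Fin; toℕ)
open import Data.Bool using (Bool; true; false; if_then_else_; _∧_)
open import Data.List using (List; map; allFin)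
open import Data.Nat.ListAction using (sum)
open import Data.Product using (Σ; _×_; ∃-syntax)
open import Relation.Binary.PropositionalEquality using (_≡_; _≢_)
open import Relation.Nullary using (¬_)

record Graph (n : ℕ) : Set where
  field
    adj   : Fin n → Fin n → Bool
    sym   : ∀ i j → adj i j ≡ adj j i
    irrefl : ∀ i → adj i i ≡ false
open Graph public

edgeCount : ∀ {n} → Graph n → ℕ
edgeCount {n} G =
  sum (map (λ i → sum (map (λ j → if (toℕ i <ᵇ toℕ j) ∧ adj G i j then 1 else 0)
                          (allFin n)))
           (allFin n))

Edge : ∀ {n} → Graph n → Fin n → Fin n → Set
Edge G i j = adj G i j ≡ true

HasC3 : ∀ {n} → Graph n → Set
HasC3 {n} G = ∃[ a ] ∃[ b ] ∃[ c ]
  (a ≢ b × a ≢ c × b ≢ c × Edge G a b × Edge G b c × Edge G c a)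

HasC4 : ∀ {n} → Graph n → Set
HasC4 {n} G = ∃[ a ] ∃[ b ] ∃[ c ] ∃[ d ]
  (a ≢ b × a ≢ c × a ≢ d × b ≢ c × b ≢ d × c ≢ d ×
   Edge G a b × Edge G b c × Edge G c d × Edge G d a)

IsExtC3C4 : ℕ → ℕ → Set
IsExtC3C4 n e =
  Σ (Graph n) (λ G → ¬ HasC3 G × ¬ HasC4 G × edgeCount G ≡ e) ×
  (∀ (G : Graph n) → ¬ HasC3 G → ¬ HasC4 G → edgeCount G ≤ e)

-- An edge-colouring of K_n using exactly k colours: a symmetric colour
-- assignment to pairs of distinct vertices (diagonal values are
-- irrelevant) such that every one of the k colours is used on some edge.
record Colouring (n k : ℕ) : Set where
  field
    col  : Fin n → Fin n → Fin k
    csym : ∀ i j → col i j ≡ col j i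
    onto : ∀ (x : Fin k) → ∃[ i ] ∃[ j ] (i ≢ j × col i j ≡ x)
open Colouring public

-- rainbow copy of the diamond D = K₄ − e: distinct vertices a,b,c,d with
-- edges ab, ac, ad, bc, bd (cd missing), all five of distinct colours.
RainbowDiamondAt : ∀ {n k} → Colouring n k → Fin n → Fin n → Fin n → Fin n → Set
RainbowDiamondAt C a b c d =
  a ≢ b × a ≢ c × a ≢ d × b ≢ c × b ≢ d × c ≢ d ×
  col C a b ≢ col C a c × col C a b ≢ col C a d ×
  col C a b ≢ col C b c × col C a b ≢ col C b d ×
  col C a c ≢ col C a d × col C a c ≢ col C b c × col C a c ≢ col C b d ×
  col C a d ≢ col C b c × col C a d ≢ col C b d ×
  col C b c ≢ col C b d

HasRainbowDiamond : ∀ {n k} → Colouring n k → Set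
HasRainbowDiamond C = ∃[ a ] ∃[ b ] ∃[ c ] ∃[ d ] RainbowDiamondAt C a b c d

Forces : ℕ → ℕ → Set
Forces n m = ∀ k → m ≤ k → (C : Colouring n k) → HasRainbowDiamond C

IsRbDiamond : ℕ → ℕ → Set
IsRbDiamond n r = Forces n r × (∀ m → m < r → ¬ Forces n m)

{-# OPTIONS --safe #-}
{-
  Extremal number.  In a graph of girth at least 5, counting the ends of paths of
  length two gives Σ deg² ≤ n(n−1).  Since deg² + 6 ≥ 5 deg, a graph with e edges has
  10e ≤ n(n+5), and ext(n) = ⌊n(n+5)/10⌋ for 4 ≤ n ≤ 10: the first n vertices of a
  suitably numbered Petersen graph attain the bound.

  Lower bound.  Colour an extremal graph rainbow and all other edges with one new
  colour.  A rainbow diamond would have four of its edges in the extremal graph, and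
  a diamond minus an edge contains C₃ or C₄.

  Upper bound, by induction on n from n = 4.  A colour survives the deletion of a vertex
  unless all its edges meet there, so it survives at least n−2 of the n deletions.
  If deleting v destroys three colours, then the three edges from v carrying them end
  in a monochromatic triangle, whose colour survives all n deletions.  For n ≠ 6 these
  counts contradict the bound for n−1.  For n = 6 averaging orders the vertices so that
  the last four span at least 4 colours and the last five at least 6, which leaves few
  enough colourings (up to renaming colours) for an exhaustive search.
-}
module Submission where

open import Defs
open import Data.Bool using (Bool; true; false; if_then_else_; _∧_; _∨_; not; T)
import Data.Bool as Bool
open import Data.Bool.ListAction using (all; any)
open import Data.Empty using (⊥)
open import Data.Fin using (Fin; zero; suc; toℕ; _≟_; punchIn; punchOut; inject≤)
import Data.Fin as Fin
open import Data.Fin.Permutation as Perm using (Permutation′; _⟨$⟩ʳ_; _⟨$⟩ˡ_; inverseʳ)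
open import Data.Fin.Properties
  using (toℕ-injective; suc-injective; inject≤-injective; any?; all?; ¬∀⟶∃¬;
         punchIn-injective; punchIn-punchOut; punchOut-injective)
open import Data.List
  using (List; []; _∷_; _++_; map; tabulate; allFin; upTo; filter; cartesianProduct; length; zip)
open import Data.List.Membership.Propositional using (_∈_; _∉_; find; lose)
open import Data.List.Membership.Propositional.Properties using (∈-upTo⁺)
import Data.List.Membership.DecPropositional as DecMembership
open import Data.List.Properties using (map-tabulate)
open import Data.List.Relation.Unary.All as All using (All; []; _∷_)
import Data.List.Relation.Unary.All.Properties as Allₚ
open import Data.List.Relation.Unary.AllPairs using (AllPairs; []; _∷_)
import Data.List.Relation.Unary.AllPairs.Properties as AllPairsₚ
open import Data.List.Relation.Unary.Any as Any using (here; there)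
open import Data.List.Relation.Unary.Unique.Propositional using (Unique)
import Data.List.Relation.Unary.Unique.Propositional.Properties as Uniqueₚ
import Data.List.Relation.Unary.Unique.DecPropositional as DecUnique
open import Data.Nat
  using (ℕ; zero; suc; _+_; _*_; _≤_; _<_; _<ᵇ_; _≡ᵇ_; _≤?_; _/_; z≤n; s≤s)
import Data.Nat as ℕ
open import Data.Nat.DivMod using (_mod_; /-monoˡ-≤; m*n/n≡m)
open import Data.Nat.ListAction using () renaming (sum to sumˡ)
open import Data.Nat.Properties as ℕₚ hiding (_≟_; _≤?_; suc-injective)
open import Data.Nat.Solver using (module +-*-Solver)
open import Data.Product using (Σ; _×_; _,_; proj₁; proj₂; ∃-syntax)
open import Data.Product.Properties using (≡-dec)
open import Data.Sum using (_⊎_; inj₁; inj₂; [_,_]′)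
open import Data.Unit using (⊤; tt)
open import Function using (_∘_; id; _on_)
open import Function.Bundles using (module Injection)
open import Function.Properties.Inverse using (↔⇒↣)
open import Level using (0ℓ)
open import Relation.Binary.Definitions using (tri<; tri≈; tri>)
open import Relation.Binary.PropositionalEquality as ≡
  using (_≡_; _≢_; refl; cong; cong₂; subst)
open import Relation.Nullary using (¬_; Dec; does; yes; no; contradiction)
open import Relation.Nullary.Decidable
  using (_×-dec_; _→-dec_; ¬?; True; toWitness; from-yes; from-no; dec-true; dec-false; decidable-stable)
open import Relation.Unary using (Pred; Decidable)
open import Algebra.Properties.Semiring.Sum +-*-semiring
  using (sum; sum-syntax; ∑-distrib-+; ∑-comm; sum-cong-≗; *-distribˡ-sum; *-distribʳ-sum)

-- Indicators and finite sums

𝟙 : Bool → ℕ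
𝟙 b = if b then 1 else 0

𝟙-∧ : ∀ b c → 𝟙 (b ∧ c) ≡ 𝟙 b * 𝟙 c
𝟙-∧ true  c = ≡.sym (+-identityʳ _)
𝟙-∧ false c = refl

∧-true : ∀ {b c} → b ∧ c ≡ true → b ≡ true × c ≡ true
∧-true {true} {true} _ = refl , refl

∨-true : ∀ {b c} → b ∨ c ≡ true → b ≡ true ⊎ c ≡ true
∨-true {true}  _ = inj₁ refl
∨-true {false} e = inj₂ e

sum-mono : ∀ {n} {f g : Fin n → ℕ} → (∀ i → f i ≤ g i) → sum f ≤ sum g
sum-mono {zero}  f≤g = z≤n
sum-mono {suc n} f≤g = +-mono-≤ (f≤g zero) (sum-mono (f≤g ∘ suc))

sum-const : ∀ n c → ∑[ i < n ] c ≡ n * c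
sum-const zero    c = refl
sum-const (suc n) c = cong (c +_) (sum-const n c)

sum-zero : ∀ {n} (f : Fin n → ℕ) → (∀ i → f i ≡ 0) → sum f ≡ 0
sum-zero {zero}  f f≡0 = refl
sum-zero {suc n} f f≡0 = cong₂ _+_ (f≡0 zero) (sum-zero (f ∘ suc) (f≡0 ∘ suc))

sum-≟ : ∀ {n} (j : Fin n) → ∑[ i < n ] 𝟙 (does (j ≟ i)) ≡ 1
sum-≟ {suc n} zero    = cong suc (sum-zero {n} _ λ _ → refl)
sum-≟ {suc n} (suc j) = sum-≟ j

sum-subsingleton : ∀ {n} (b : Fin n → Bool) →
  (∀ i j → b i ≡ true → b j ≡ true → i ≡ j) → ∑[ i < n ] 𝟙 (b i) ≤ 1
sum-subsingleton {zero}  b unique = z≤n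
sum-subsingleton {suc n} b unique with b zero in b₀
... | false = sum-subsingleton (b ∘ suc) λ i j p q → suc-injective (unique _ _ p q)
... | true  = ≤-reflexive (cong suc (sum-zero (𝟙 ∘ b ∘ suc) absent))
  where
  absent : ∀ i → 𝟙 (b (suc i)) ≡ 0
  absent i with b (suc i) in bᵢ
  ... | false = refl
  ... | true  with () ← unique zero (suc i) b₀ bᵢ

sumˡ-allFin : ∀ {n} (f : Fin n → ℕ) → sumˡ (map f (allFin n)) ≡ sum f
sumˡ-allFin f = ≡.trans (cong sumˡ (map-tabulate id f)) (go f)
  where
  go : ∀ {n} (f : Fin n → ℕ) → sumˡ (tabulate f) ≡ sum f
  go {zero}  f = refl
  go {suc n} f = cong (f zero +_) (go (f ∘ suc))

-- Edges in graphs without `C₃` and `C₄`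

ext : ℕ → ℕ
ext n = n * (n + 5) / 10

module _ {n : ℕ} (G : Graph n) where

  degree : Fin n → ℕ
  degree v = ∑[ w < n ] 𝟙 (adj G v w)

  -- Only pairs with `i < j` enter `edgeCount`; transposing the second copy makes the two copies
  -- together run over all ordered pairs.
  handshake : edgeCount G + edgeCount G ≡ ∑[ v < n ] degree v
  handshake = begin
    edgeCount G + edgeCount G
      ≡⟨ cong₂ _+_ unfold (≡.trans unfold (∑-comm upper)) ⟩
    (∑[ i < n ] ∑[ j < n ] upper i j) + (∑[ i < n ] ∑[ j < n ] upper j i)
      ≡⟨ ∑-distrib-+ _ (λ i → ∑[ j < n ] upper j i) ⟨
    ∑[ i < n ] (∑[ j < n ] upper i j + ∑[ j < n ] upper j i)
      ≡⟨ sum-cong-≗ (λ i → ≡.trans (≡.sym (∑-distrib-+ (upper i) (λ j → upper j i)))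
                                   (sum-cong-≗ (orient i))) ⟩
    ∑[ i < n ] degree i ∎
    where
    open ≡.≡-Reasoning
    upper : Fin n → Fin n → ℕ
    upper i j = 𝟙 ((toℕ i <ᵇ toℕ j) ∧ adj G i j)
    unfold : edgeCount G ≡ ∑[ i < n ] ∑[ j < n ] upper i j
    unfold = ≡.trans (sumˡ-allFin λ i → sumˡ (map (upper i) (allFin n)))
                     (sum-cong-≗ λ i → sumˡ-allFin (upper i))
    orient : ∀ i j → upper i j + upper j i ≡ 𝟙 (adj G i j)
    orient i j with ℕₚ.<-cmp (toℕ i) (toℕ j)
    ... | tri< p _ q rewrite dec-true (toℕ i ℕ.<? toℕ j) p | dec-false (toℕ j ℕ.<? toℕ i) q =
      +-identityʳ _
    ... | tri> p _ q rewrite dec-false (toℕ i ℕ.<? toℕ j) p | dec-true (toℕ j ℕ.<? toℕ i) q =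
      cong 𝟙 (Graph.sym G j i)
    ... | tri≈ p e q with refl ← toℕ-injective e
      rewrite irrefl G i | dec-false (toℕ i ℕ.<? toℕ i) p = refl

  codegree : Fin n → Fin n → ℕ
  codegree a w = ∑[ v < n ] 𝟙 (adj G a v ∧ adj G v w)

  distinct-ends : ∀ {i j} → Edge G i j → i ≢ j
  distinct-ends {i} e refl with () ← ≡.trans (≡.sym e) (irrefl G i)

  reverse-edge : ∀ {i j} → Edge G i j → Edge G j i
  reverse-edge {i} {j} e = ≡.trans (Graph.sym G j i) e

  -- Both sides count walks of length two, on the left by their ends and on the right by their
  -- midpoint.
  sum-codegree : ∑[ a < n ] ∑[ w < n ] codegree a w ≡ ∑[ v < n ] (degree v * degree v)
  sum-codegree = begin
    ∑[ a < n ] ∑[ w < n ] codegree a w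
      ≡⟨ sum-cong-≗ (λ a → ∑-comm (λ w v → 𝟙 (adj G a v ∧ adj G v w))) ⟩
    ∑[ a < n ] ∑[ v < n ] ∑[ w < n ] 𝟙 (adj G a v ∧ adj G v w)
      ≡⟨ ∑-comm (λ a v → ∑[ w < n ] 𝟙 (adj G a v ∧ adj G v w)) ⟩
    ∑[ v < n ] ∑[ a < n ] ∑[ w < n ] 𝟙 (adj G a v ∧ adj G v w)
      ≡⟨ sum-cong-≗ (λ v → sum-cong-≗ λ a → ≡.trans
           (sum-cong-≗ λ w → ≡.trans (𝟙-∧ (adj G a v) (adj G v w))
                                     (cong (λ b → 𝟙 b * 𝟙 (adj G v w)) (Graph.sym G a v)))
           (≡.sym (*-distribˡ-sum (𝟙 (adj G v a)) λ w → 𝟙 (adj G v w)))) ⟩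
    ∑[ v < n ] ∑[ a < n ] (𝟙 (adj G v a) * degree v)
      ≡⟨ sum-cong-≗ (λ v → ≡.sym (*-distribʳ-sum (degree v) λ a → 𝟙 (adj G v a))) ⟩
    ∑[ v < n ] (degree v * degree v) ∎
    where open ≡.≡-Reasoning

  module _ (noC3 : ¬ HasC3 G) (noC4 : ¬ HasC4 G) where

    -- Distinct vertices have at most one common neighbour, and none if they are adjacent.
    codegree-≤ : ∀ a w → codegree a w + 𝟙 (adj G a w) + 𝟙 (does (a ≟ w))
                       ≤ 1 + 𝟙 (does (a ≟ w)) * degree a
    codegree-≤ a w with a ≟ w
    ... | yes refl rewrite irrefl G a | +-identityʳ (codegree a a) | +-identityʳ (degree a)
                         | +-comm (codegree a a) 1 =
      s≤s (sum-mono λ v → left (adj G a v) (adj G v a))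
      where
      left : ∀ b c → 𝟙 (b ∧ c) ≤ 𝟙 b
      left true  true  = ≤-refl
      left true  false = z≤n
      left false _     = z≤n
    ... | no a≢w rewrite +-identityʳ (codegree a w + 𝟙 (adj G a w)) with adj G a w in e
    ...   | true  = ≤-reflexive (cong (_+ 1) (sum-zero _ apart))
      where
      apart : ∀ v → 𝟙 (adj G a v ∧ adj G v w) ≡ 0
      apart v with adj G a v in f | adj G v w in g
      ... | false | _     = refl
      ... | true  | false = refl
      ... | true  | true  = contradiction
        (a , v , w , distinct-ends f , a≢w , distinct-ends g , f , g , reverse-edge e) noC3
    ...   | false rewrite +-identityʳ (codegree a w) = sum-subsingleton _ unique
      where
      unique : ∀ u v → adj G a u ∧ adj G u w ≡ true → adj G a v ∧ adj G v w ≡ true → u ≡ v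
      unique u v p q with u ≟ v | ∧-true p | ∧-true q
      ... | yes u≡v | _ | _ = u≡v
      ... | no  u≢v | au , uw | av , vw = contradiction
        (a , u , w , v , distinct-ends au , a≢w , distinct-ends av , distinct-ends uw , u≢v
           , distinct-ends (reverse-edge vw) , au , uw , reverse-edge vw , reverse-edge av) noC4

    -- In the sum of `codegree-≤` over `w`, the adjacency terms on the left and the diagonal term on
    -- the right each give `degree a`, which cancels.
    sum-codegree-≤ : ∀ a → ∑[ w < n ] codegree a w + 1 ≤ n
    sum-codegree-≤ a = +-cancelʳ-≤ (degree a) _ _ (begin
      (∑[ w < n ] codegree a w + 1) + degree a
        ≡⟨ +-assoc (∑[ w < n ] codegree a w) 1 _ ⟩
      ∑[ w < n ] codegree a w + (1 + degree a)
        ≡⟨ cong (∑[ w < n ] codegree a w +_) (+-comm 1 _) ⟩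
      ∑[ w < n ] codegree a w + (degree a + 1)
        ≡⟨ +-assoc (∑[ w < n ] codegree a w) _ 1 ⟨
      (∑[ w < n ] codegree a w + degree a) + 1
        ≡⟨ cong₂ _+_ (∑-distrib-+ (codegree a) _) (sum-≟ a) ⟨
      (∑[ w < n ] (codegree a w + 𝟙 (adj G a w))) + ∑[ w < n ] 𝟙 (does (a ≟ w))
        ≡⟨ ∑-distrib-+ _ (λ w → 𝟙 (does (a ≟ w))) ⟨
      ∑[ w < n ] (codegree a w + 𝟙 (adj G a w) + 𝟙 (does (a ≟ w)))
        ≤⟨ sum-mono (codegree-≤ a) ⟩
      ∑[ w < n ] (1 + 𝟙 (does (a ≟ w)) * degree a)
        ≡⟨ ∑-distrib-+ (λ _ → 1) (λ w → 𝟙 (does (a ≟ w)) * degree a) ⟩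
      (∑[ w < n ] 1) + ∑[ w < n ] (𝟙 (does (a ≟ w)) * degree a)
        ≡⟨ cong₂ _+_ (≡.trans (sum-const n 1) (*-identityʳ n))
             (≡.trans (≡.sym (*-distribʳ-sum (degree a) λ w → 𝟙 (does (a ≟ w))))
                      (≡.trans (cong (_* degree a) (sum-≟ a)) (*-identityˡ _))) ⟩
      n + degree a ∎)
      where open ≤-Reasoning

    -- The factor `10` is the `5` of `parabola` times the `2` of `handshake`. The extra `n` on both
    -- sides avoids subtraction.
    edgeCount-bound : edgeCount G * 10 ≤ n * (n + 5)
    edgeCount-bound = +-cancelʳ-≤ n _ _ (begin
      edgeCount G * 10 + n
        ≡⟨ cong (_+ n) (solve 1 (λ e → e :* con 10 := con 5 :* (e :+ e)) refl (edgeCount G)) ⟩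
      5 * (edgeCount G + edgeCount G) + n
        ≡⟨ cong (λ s → 5 * s + n) handshake ⟩
      5 * sum degree + n
        ≡⟨ cong (_+ n) (*-distribˡ-sum 5 degree) ⟩
      ∑[ v < n ] (5 * degree v) + n
        ≤⟨ +-monoˡ-≤ n (sum-mono (λ v → parabola (degree v))) ⟩
      ∑[ v < n ] (degree v * degree v + 6) + n
        ≡⟨ cong (_+ n) (≡.trans (∑-distrib-+ (λ v → degree v * degree v) (λ _ → 6))
                          (cong₂ _+_ (≡.sym sum-codegree) (sum-const n 6))) ⟩
      (paths + n * 6) + n
        ≡⟨ solve 2 (λ p m → (p :+ m :* con 6) :+ m := (p :+ m :* con 1) :+ m :* con 6) refl paths n ⟩
      (paths + n * 1) + n * 6
        ≡⟨ cong (_+ n * 6) (≡.trans (∑-distrib-+ (λ a → ∑[ w < n ] codegree a w) (λ _ → 1))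
                              (cong (paths +_) (sum-const n 1))) ⟨
      ∑[ a < n ] (∑[ w < n ] codegree a w + 1) + n * 6
        ≤⟨ +-monoˡ-≤ (n * 6) (sum-mono sum-codegree-≤) ⟩
      (∑[ a < n ] n) + n * 6
        ≡⟨ cong (_+ n * 6) (sum-const n n) ⟩
      n * n + n * 6
        ≡⟨ solve 1 (λ m → m :* m :+ m :* con 6 := m :* (m :+ con 5) :+ m) refl n ⟩
      n * (n + 5) + n ∎)
      where
      open ≤-Reasoning
      open +-*-Solver
      paths : ℕ
      paths = ∑[ a < n ] ∑[ w < n ] codegree a w
      -- The difference of the two sides is `(d - 2)(d - 3)`, which is never negative on integers.
      parabola : ∀ d → 5 * d ≤ d * d + 6
      parabola 0 = z≤n
      parabola 1 = m≤n+m 5 2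
      parabola 2 = ≤-refl
      parabola (suc (suc (suc d))) = begin
        5 * (3 + d)             ≤⟨ m≤m+n _ (d * d + d) ⟩
        5 * (3 + d) + (d * d + d)
          ≡⟨ solve 1 (λ x → con 5 :* (con 3 :+ x) :+ (x :* x :+ x)
                         := (con 3 :+ x) :* (con 3 :+ x) :+ con 6) refl d ⟩
        (3 + d) * (3 + d) + 6   ∎

    edgeCount-≤ : edgeCount G ≤ ext n
    edgeCount-≤ = ≤-trans (≤-reflexive (≡.sym (m*n/n≡m (edgeCount G) 10))) (/-monoˡ-≤ 10 edgeCount-bound)

-- The Petersen graph

-- Numbered so that for 4 ≤ n ≤ 10 the first n vertices induce ext n edges, which
-- are the first ext n of the list.
petersenEdges : List (ℕ × ℕ)
petersenEdges =
  (0 , 1) ∷ (1 , 2) ∷ (2 , 3) ∷ (3 , 4) ∷ (0 , 4) ∷ (0 , 5) ∷ (2 , 6) ∷ (5 , 6) ∷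
  (4 , 7) ∷ (6 , 7) ∷ (1 , 8) ∷ (7 , 8) ∷ (3 , 9) ∷ (5 , 9) ∷ (8 , 9) ∷ []

position : List (ℕ × ℕ) → ℕ → ℕ → ℕ → ℕ
position []             k i j = 0
position ((a , b) ∷ es) k i j =
  if (i ≡ᵇ a) ∧ (j ≡ᵇ b) ∨ (i ≡ᵇ b) ∧ (j ≡ᵇ a) then k else position es (suc k) i j

-- The position of an edge in the list, counted from 1; 0 for non-edges.
label : Fin 10 → Fin 10 → ℕ
label i j = position petersenEdges 1 (toℕ i) (toℕ j)

label-sym : ∀ i j → label i j ≡ label j i
label-sym = from-yes (all? λ i → all? λ j → label i j ℕ.≟ label j i)

petersen : Graph 10
petersen = record
  { adj    = λ i j → 0 <ᵇ label i j
  ; sym    = λ i j → cong (0 <ᵇ_) (label-sym i j)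
  ; irrefl = from-yes (all? λ i → (0 <ᵇ label i i) Bool.≟ false)
  }

edge? : ∀ {n} (G : Graph n) i j → Dec (Edge G i j)
edge? G i j = adj G i j Bool.≟ true

petersen-noC3 : ¬ HasC3 petersen
petersen-noC3 (a , b , c , _ , _ , _ , ab , bc , ca) = noTriangle (a , b , ab , c , bc , ca)
  where
  -- Adjacency is tested as soon as both ends are chosen, which prunes the enumeration.
  noTriangle : ¬ (∃[ a ] ∃[ b ] (Edge petersen a b × (∃[ c ] (Edge petersen b c × Edge petersen c a))))
  noTriangle = from-no (any? λ a → any? λ b → edge? petersen a b ×-dec
    any? λ c → edge? petersen b c ×-dec edge? petersen c a)

petersen-noC4 : ¬ HasC4 petersen
petersen-noC4 (a , b , c , d , _ , a≢c , _ , _ , b≢d , _ , ab , bc , cd , da) =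
  noSquare (a , b , ab , c , bc , a≢c , d , cd , da , b≢d)
  where
  noSquare : ¬ (∃[ a ] ∃[ b ] (Edge petersen a b × (∃[ c ] (Edge petersen b c × a ≢ c ×
               (∃[ d ] (Edge petersen c d × Edge petersen d a × b ≢ d))))))
  noSquare = from-no (any? λ a → any? λ b → edge? petersen a b ×-dec
    any? λ c → edge? petersen b c ×-dec ¬? (a ≟ c) ×-dec
    any? λ d → edge? petersen c d ×-dec edge? petersen d a ×-dec ¬? (b ≟ d))

-- Induced subgraphs and the lower-bound colouring

induced : ∀ {m n} → (Fin m → Fin n) → Graph n → Graph m
induced ι G = record
  { adj    = λ i j → adj G (ι i) (ι j)
  ; sym    = λ i j → Graph.sym G (ι i) (ι j)
  ; irrefl = λ i → irrefl G (ι i)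
  }

module _ {m n} {ι : Fin m → Fin n} (ι-injective : ∀ {i j} → ι i ≡ ι j → i ≡ j) (G : Graph n) where

  induced-C3 : HasC3 (induced ι G) → HasC3 G
  induced-C3 (a , b , c , a≢b , a≢c , b≢c , es) =
    ι a , ι b , ι c , a≢b ∘ ι-injective , a≢c ∘ ι-injective , b≢c ∘ ι-injective , es

  induced-C4 : HasC4 (induced ι G) → HasC4 G
  induced-C4 (a , b , c , d , a≢b , a≢c , a≢d , b≢c , b≢d , c≢d , es) =
    ι a , ι b , ι c , ι d , a≢b ∘ ι-injective , a≢c ∘ ι-injective , a≢d ∘ ι-injective ,
    b≢c ∘ ι-injective , b≢d ∘ ι-injective , c≢d ∘ ι-injective , es

-- A rainbow diamond has at most one edge of the background colour z; deleting
-- any edge from a diamond leaves a triangle, or a 4-cycle if it is the spine ab.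
background-noRainbow : ∀ {n k} (G : Graph n) (C : Colouring n k) (z : Fin k) →
  (∀ i j → col C i j ≢ z → Edge G i j) → ¬ HasC3 G → ¬ HasC4 G → ¬ HasRainbowDiamond C
background-noRainbow G C z fg noC3 noC4
  (a , b , c , d , a≢b , a≢c , a≢d , b≢c , b≢d , c≢d ,
   ab≢ac , ab≢ad , ab≢bc , ab≢bd , ac≢ad , ac≢bc , ac≢bd , ad≢bc , ad≢bd , bc≢bd)
  with col C a b ≟ z | col C a c ≟ z | col C b c ≟ z
... | yes ab | _      | _      = noC4
  (a , c , b , d , a≢c , a≢b , a≢d , b≢c ∘ ≡.sym , c≢d , b≢d ,
   fg a c (ab≢ac ∘ joined ab) , reverse-edge G (fg b c (ab≢bc ∘ joined ab)) ,
   fg b d (ab≢bd ∘ joined ab) , reverse-edge G (fg a d (ab≢ad ∘ joined ab)))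
  where
  joined : ∀ {x y} → x ≡ z → y ≡ z → x ≡ y
  joined p q = ≡.trans p (≡.sym q)
... | no ab  | no ac  | no bc  = noC3
  (a , b , c , a≢b , a≢c , b≢c , fg a b ab , fg b c bc , reverse-edge G (fg a c ac))
... | no ab  | yes ac | _      = noC3
  (a , b , d , a≢b , a≢d , b≢d , fg a b ab , fg b d (λ bd → ac≢bd (≡.trans ac (≡.sym bd))) ,
   reverse-edge G (fg a d (λ ad → ac≢ad (≡.trans ac (≡.sym ad)))))
... | no ab  | no _   | yes bc = noC3
  (a , b , d , a≢b , a≢d , b≢d , fg a b ab , fg b d (λ bd → bc≢bd (≡.trans bc (≡.sym bd))) ,
   reverse-edge G (fg a d (λ ad → ad≢bc (≡.trans ad (≡.sym bc)))))

module _ {n : ℕ} (n≤10 : n ≤ 10) where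

  ι : Fin n → Fin 10
  ι i = inject≤ i n≤10

  initial : Graph n
  initial = induced ι petersen

  initial-noC3 : ¬ HasC3 initial
  initial-noC3 = petersen-noC3 ∘ induced-C3 (inject≤-injective n≤10 n≤10 _ _) petersen

  initial-noC4 : ¬ HasC4 initial
  initial-noC4 = petersen-noC4 ∘ induced-C4 (inject≤-injective n≤10 n≤10 _ _) petersen

  -- No truncation occurs for 4 ≤ n: the labels on the first n vertices are at most ext n.
  colour : Fin n → Fin n → Fin (suc (ext n))
  colour i j = label (ι i) (ι j) mod suc (ext n)

  colour-onto? : Dec (∀ x → ∃[ i ] ∃[ j ] (i ≢ j × colour i j ≡ x))
  colour-onto? = all? λ x → any? λ i → any? λ j → ¬? (i ≟ j) ×-dec colour i j ≟ x

  module _ (onto : ∀ x → ∃[ i ] ∃[ j ] (i ≢ j × colour i j ≡ x)) where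

    colouring : Colouring n (suc (ext n))
    colouring = record
      { col  = colour
      ; csym = λ i j → cong (_mod suc (ext n)) (label-sym (ι i) (ι j))
      ; onto = onto
      }

    foreground : ∀ i j → colour i j ≢ zero → Edge initial i j
    foreground i j with label (ι i) (ι j)
    ... | zero  = contradiction refl
    ... | suc _ = λ _ → refl

    colouring-noRainbow : ¬ HasRainbowDiamond colouring
    colouring-noRainbow =
      background-noRainbow initial colouring zero foreground initial-noC3 initial-noC4

-- Counting colours

module _ {n : ℕ} where
  open DecMembership (_≟_ {n}) using (_∈?_) public

count : ∀ {n} {P : Pred (Fin n) 0ℓ} → Decidable P → ℕ
count {n} P? = ∑[ i < n ] 𝟙 (does (P? i))

count-∪ : ∀ {n} {P Q R : Pred (Fin n) 0ℓ} (P? : Decidable P) (Q? : Decidable Q) (R? : Decidable R) →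
  (∀ i → P i → Q i ⊎ R i) → count P? ≤ count Q? + count R?
count-∪ P? Q? R? split =
  ≤-trans (sum-mono pointwise) (≤-reflexive (∑-distrib-+ (𝟙 ∘ does ∘ Q?) (𝟙 ∘ does ∘ R?)))
  where
  pointwise : ∀ i → 𝟙 (does (P? i)) ≤ 𝟙 (does (Q? i)) + 𝟙 (does (R? i))
  pointwise i with P? i | Q? i | R? i
  ... | no  _ | _     | _     = z≤n
  ... | yes _ | yes _ | _     = s≤s z≤n
  ... | yes _ | no _  | yes _ = s≤s z≤n
  ... | yes p | no ¬q | no ¬r with split i p
  ...   | inj₁ q = contradiction q ¬q
  ...   | inj₂ r = contradiction r ¬r

count-∈ : ∀ {n} (l : List (Fin n)) → count (_∈? l) ≤ length l
count-∈ {n} []      = ≤-reflexive (sum-zero {n} (λ i → 𝟙 (does (i ∈? []))) λ _ → refl)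
count-∈ (j ∷ l) = ≤-trans
  (count-∪ (_∈? (j ∷ l)) (j ≟_) (_∈? l) λ { i (here i≡j) → inj₁ (≡.sym i≡j) ; i (there i∈l) → inj₂ i∈l })
  (+-mono-≤ (≤-reflexive (sum-≟ j)) (count-∈ l))

count-cover : ∀ {n} {P Q : Pred (Fin n) 0ℓ} (P? : Decidable P) (Q? : Decidable Q) l →
  (∀ i → P i → Q i ⊎ i ∈ l) → count P? ≤ count Q? + length l
count-cover P? Q? l split =
  ≤-trans (count-∪ P? Q? (_∈? l) split) (+-monoʳ-≤ (count Q?) (count-∈ l))

count-all : ∀ {n} {Q : Pred (Fin n) 0ℓ} (Q? : Decidable Q) l →
  (∀ i → Q i ⊎ i ∈ l) → n ≤ count Q? + length l
count-all {n} Q? l split = ≤-trans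
  (≤-reflexive (≡.sym (≡.trans (sum-const n 1) (*-identityʳ n))))
  (count-cover (λ i → yes i) Q? l λ i _ → split i)

nothing : ∀ {n} → Decidable {A = Fin n} λ _ → ⊥
nothing _ = no λ ()

-- Shadings, palettes and vertex deletion

-- Unlike a Colouring, not required to use all colours, so that vertices can be deleted.
Shading : ℕ → ℕ → Set
Shading n k = Fin n → Fin n → Fin k

Symmetric : ∀ {n k} → Shading n k → Set
Symmetric f = ∀ i j → f i j ≡ f j i

Quad : ℕ → Set
Quad n = Fin n × Fin n × Fin n × Fin n

Rainbow : ∀ {n k} → Shading n k → Quad n → Set
Rainbow f (a , b , c , d) =
  Unique (a ∷ b ∷ c ∷ d ∷ []) × Unique (f a b ∷ f a c ∷ f a d ∷ f b c ∷ f b d ∷ [])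

rainbow? : ∀ {n k} (f : Shading n k) q → Dec (Rainbow f q)
rainbow? f (a , b , c , d) = DecUnique.unique? _≟_ _ ×-dec DecUnique.unique? _≟_ _

DiamondFree : ∀ {n k} → Shading n k → Set
DiamondFree f = ∀ q → ¬ Rainbow f q

diamondFree-on : ∀ {m n k} {f : Shading n k} {ι : Fin m → Fin n} →
  (∀ {i j} → ι i ≡ ι j → i ≡ j) → DiamondFree f → DiamondFree (f on ι)
diamondFree-on ι-injective free (a , b , c , d) (vertices , colours) =
  free _ (Uniqueₚ.map⁺ ι-injective vertices , colours)

Used : ∀ {n k} → Shading n k → Fin k → Set
Used f x = ∃[ i ] ∃[ j ] (i ≢ j × f i j ≡ x)

-- Abstract to keep the type checker from unfolding the search in counts of used colours.
abstract
  used? : ∀ {n k} (f : Shading n k) → Decidable (Used f)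
  used? f x = any? λ i → any? λ j → ¬? (i ≟ j) ×-dec f i j ≟ x

palette : ∀ {n k} → Shading n k → ℕ
palette f = count (used? f)

palette-onto : ∀ {n k} (f : Shading n k) → (∀ x → Used f x) → k ≤ palette f
palette-onto f onto = ≤-trans (count-all (used? f) [] (inj₁ ∘ onto)) (≤-reflexive (+-identityʳ _))

palette-cover : ∀ {n k} (f : Shading n k) l → (∀ x → Used f x → x ∈ l) → palette f ≤ length l
palette-cover {k = k} f l covered = ≤-trans
  (count-cover (used? f) (nothing {k}) l (λ x → inj₂ ∘ covered x))
  (≤-reflexive (cong (_+ length l) (sum-zero {k} (λ x → 𝟙 (does (nothing x))) λ _ → refl)))

palette-permute : ∀ {n k} (f : Shading n k) (π : Permutation′ n) →
  palette f ≤ palette (f on (π ⟨$⟩ʳ_))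
palette-permute f π = ≤-trans
  (count-cover (used? f) (used? (f on (π ⟨$⟩ʳ_))) [] λ x (i , j , i≢j , e) → inj₁
    (π ⟨$⟩ˡ i , π ⟨$⟩ˡ j ,
     (λ p → i≢j (≡.trans (≡.sym (inverseʳ π)) (≡.trans (cong (π ⟨$⟩ʳ_) p) (inverseʳ π)))) ,
     ≡.trans (cong₂ f (inverseʳ π) (inverseʳ π)) e))
  (≤-reflexive (+-identityʳ _))

delete : ∀ {n k} → Fin (suc n) → Shading (suc n) k → Shading n k
delete v f = f on punchIn v

used-delete : ∀ {n k} {f : Shading (suc n) k} {v i j x} →
  v ≢ i → v ≢ j → i ≢ j → f i j ≡ x → Used (delete v f) x
used-delete {f = f} v≢i v≢j i≢j e =
  punchOut v≢i , punchOut v≢j , i≢j ∘ punchOut-injective v≢i v≢j ,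
  ≡.trans (cong₂ f (punchIn-punchOut v≢i) (punchIn-punchOut v≢j)) e

module _ {r k : ℕ} (f : Shading (2 + r) k) where

  -- A used colour survives all but at most two of the single-vertex deletions;
  -- P collects colours that survive all of them.
  averaging : {P : Pred (Fin k) 0ℓ} (P? : Decidable P) →
    (∀ {x} → P x → ∀ v → Used (delete v f) x) →
    r * palette f + 2 * count P? ≤ ∑[ v < 2 + r ] palette (delete v f)
  averaging {P} P? persistent = begin
    r * palette f + 2 * count P?
      ≡⟨ cong₂ _+_ (*-distribˡ-sum r (λ x → 𝟙 (does (used? f x))))
                   (*-distribˡ-sum 2 (λ x → 𝟙 (does (P? x)))) ⟩
    ∑[ x < k ] (r * 𝟙 (does (used? f x))) + ∑[ x < k ] (2 * 𝟙 (does (P? x)))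
      ≡⟨ ∑-distrib-+ (λ x → r * 𝟙 (does (used? f x))) (λ x → 2 * 𝟙 (does (P? x))) ⟨
    ∑[ x < k ] (r * 𝟙 (does (used? f x)) + 2 * 𝟙 (does (P? x)))
      ≤⟨ sum-mono pointwise ⟩
    ∑[ x < k ] count (λ v → used? (delete v f) x)
      ≡⟨ ∑-comm (λ x v → 𝟙 (does (used? (delete v f) x))) ⟩
    ∑[ v < 2 + r ] palette (delete v f) ∎
    where
    open ≤-Reasoning

    pointwise : ∀ x → r * 𝟙 (does (used? f x)) + 2 * 𝟙 (does (P? x))
                    ≤ count (λ v → used? (delete v f) x)
    pointwise x with P? x | used? f x
    ... | yes p | u? = ≤-trans (at-most (does u?))
      (≤-trans (count-all (λ v → used? (delete v f) x) [] λ v → inj₁ (persistent p v))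
               (≤-reflexive (+-identityʳ _)))
      where
      at-most : ∀ b → r * 𝟙 b + 2 ≤ 2 + r
      at-most true  = ≤-reflexive (≡.trans (cong (_+ 2) (*-identityʳ r)) (+-comm r 2))
      at-most false rewrite *-zeroʳ r = m≤m+n 2 r
    ... | no _  | no _ rewrite *-zeroʳ r = z≤n
    ... | no _  | yes (i , j , i≢j , e) rewrite *-identityʳ r | +-identityʳ r =
      +-cancelʳ-≤ 2 r _ (≤-trans (≤-reflexive (+-comm r 2))
        (count-all (λ v → used? (delete v f) x) (i ∷ j ∷ []) split))
      where
      -- Only the ends `i` and `j` of one chosen edge of colour `x` can destroy `x` when deleted.
      split : ∀ v → Used (delete v f) x ⊎ v ∈ i ∷ j ∷ []
      split v with v ≟ i | v ≟ j
      ... | yes v≡i | _       = inj₂ (here v≡i)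
      ... | no _    | yes v≡j = inj₂ (there (here v≡j))
      ... | no v≢i  | no v≢j  = inj₁ (used-delete v≢i v≢j i≢j e)

  -- Pigeonhole on `averaging`, with no colours singled out as persistent.
  rich-deletion : ∀ b → (2 + r) * b < r * palette f → ∃[ v ] b < palette (delete v f)
  rich-deletion b small =
    let v , rich = ¬∀⟶∃¬ (2 + r) _ (λ v → palette (delete v f) ≤? b) not-all-poor in v , ≰⇒> rich
    where
    open ≤-Reasoning
    not-all-poor : ¬ (∀ v → palette (delete v f) ≤ b)
    not-all-poor poor = <⇒≱ small (begin
      r * palette f
        ≤⟨ m≤m+n _ (2 * count (nothing {k})) ⟩
      r * palette f + 2 * count (nothing {k})
        ≤⟨ averaging (nothing {k}) (λ ()) ⟩
      ∑[ v < 2 + r ] palette (delete v f)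
        ≤⟨ sum-mono poor ⟩
      ∑[ v < 2 + r ] b
        ≡⟨ sum-const (2 + r) b ⟩
      (2 + r) * b ∎)

module _ {n k : ℕ} {f : Shading (suc n) k} (f-sym : Symmetric f) (free : DiamondFree f)
         {v : Fin (suc n)} (gap : palette (delete v f) + 3 ≤ palette f) where

  private
    Lost : Fin k → Set
    Lost x = ¬ Used (delete v f) x

  -- At least three colours are lost, and each lies only on edges at `v`, so fewer than three listed
  -- colours cannot exhaust them. Three applications yield three edges at `v` with distinct lost
  -- colours.
  lost-edge : ∀ l → length l < 3 → ∃[ u ] (v ≢ u × Lost (f v u) × f v u ∉ l)
  lost-edge l short
    with any? (λ u → ¬? (v ≟ u) ×-dec ¬? (used? (delete v f) (f v u)) ×-dec ¬? (f v u ∈? l))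
  ... | yes found = found
  ... | no  none  = contradiction
    (≤-trans gap (count-cover (used? f) (used? (delete v f)) l split))
    (<⇒≱ (+-monoʳ-< (palette (delete v f)) short))
    where
    at : ∀ u {x} → v ≢ u → f v u ≡ x → Used (delete v f) x ⊎ x ∈ l
    at u v≢u refl with used? (delete v f) (f v u) | f v u ∈? l
    ... | yes used | _         = inj₁ used
    ... | no _     | yes x∈l   = inj₂ x∈l
    ... | no lost  | no x∉l    = contradiction (u , v≢u , lost , x∉l) none
    split : ∀ x → Used f x → Used (delete v f) x ⊎ x ∈ l
    split x (i , j , i≢j , e) with v ≟ i | v ≟ j
    ... | yes refl | _        = at j i≢j e
    ... | no v≢i   | yes refl = at i v≢i (≡.trans (f-sym v i) e)
    ... | no v≢i   | no v≢j   = inj₁ (used-delete v≢i v≢j i≢j e)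

  -- The diamond with spine va and tips b, c is rainbow unless ab and ac agree.
  fan : ∀ {a b c} → v ≢ a → v ≢ b → v ≢ c → Lost (f v a) → Lost (f v b) → Lost (f v c) →
    f v a ≢ f v b → f v a ≢ f v c → f v b ≢ f v c → f a b ≡ f a c
  fan {a} {b} {c} v≢a v≢b v≢c lost-a lost-b lost-c ab ac bc =
    decidable-stable (f a b ≟ f a c) λ differ → free (v , a , b , c)
      ( ( (v≢a ∷ v≢b ∷ v≢c ∷ []) ∷ (a≢b ∷ a≢c ∷ []) ∷ ((bc ∘ cong (f v)) ∷ []) ∷ [] ∷ [])
      , ( (ab ∷ ac ∷ off lost-a v≢b a≢b ∷ off lost-a v≢c a≢c ∷ [])
        ∷ (bc ∷ off lost-b v≢b a≢b ∷ off lost-b v≢c a≢c ∷ [])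
        ∷ (off lost-c v≢b a≢b ∷ off lost-c v≢c a≢c ∷ [])
        ∷ (differ ∷ []) ∷ [] ∷ []))
    where
    a≢b : a ≢ b
    a≢b = ab ∘ cong (f v)
    a≢c : a ≢ c
    a≢c = ac ∘ cong (f v)
    off : ∀ {x y} → Lost x → v ≢ y → a ≢ y → x ≢ f a y
    off lost v≢y a≢y e = lost (used-delete v≢a v≢y a≢y (≡.sym e))

  -- The colour of a monochromatic triangle.
  persistent-colour : ∃[ x ] ∀ w → Used (delete w f) x
  persistent-colour with lost-edge [] (s≤s z≤n)
  ... | a , v≢a , lost-a , _ with lost-edge (f v a ∷ []) (s≤s (s≤s z≤n))
  ... | b , v≢b , lost-b , b∉ with lost-edge (f v a ∷ f v b ∷ []) (s≤s (s≤s (s≤s z≤n)))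
  ... | c , v≢c , lost-c , c∉ = f a b , survives
    where
    ab : f v a ≢ f v b
    ab = b∉ ∘ here ∘ ≡.sym
    ac : f v a ≢ f v c
    ac = c∉ ∘ here ∘ ≡.sym
    bc : f v b ≢ f v c
    bc = c∉ ∘ there ∘ here ∘ ≡.sym
    survives : ∀ w → Used (delete w f) (f a b)
    -- Some side of the triangle `abc` avoids `w`: `ab` in general, `bc` if `w` is `a`, and `ac` if
    -- `w` is `b`.
    survives w with w ≟ a | w ≟ b
    ... | no w≢a   | no w≢b   = used-delete w≢a w≢b (ab ∘ cong (f v)) refl
    ... | yes refl | _        = used-delete (ab ∘ cong (f v)) (ac ∘ cong (f v)) (bc ∘ cong (f v))
      (≡.trans (≡.sym (fan v≢b v≢a v≢c lost-b lost-a lost-c (ab ∘ ≡.sym) bc ac)) (f-sym b a))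
    ... | no _     | yes refl = used-delete (ab ∘ cong (f v) ∘ ≡.sym) (bc ∘ cong (f v)) (ac ∘ cong (f v))
      (≡.sym (fan v≢a v≢b v≢c lost-a lost-b lost-c ab ac bc))

Bound : ℕ → ℕ → Set
Bound n m = ∀ {k} (f : Shading n k) → Symmetric f → DiamondFree f → palette f ≤ m

-- Suppose more than `M` colours occur. By the first numerical condition every deletion loses at
-- least three, so a persistent colour exists. It adds `2` to the estimate in `averaging`, and by
-- the second condition the total exceeds the `(2 + r) * m` that the deletions can supply.
bound-step : ∀ {r m M} {_ : True (m + 3 ≤? suc M)} {_ : True ((2 + r) * m ℕ.<? r * suc M + 2)} →
  Bound (suc r) m → Bound (2 + r) M
bound-step {r} {m} {M} {big-gap} {small} bound {k} f f-sym free = ≮⇒≥ impossible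
  where
  poor : ∀ v → palette (delete v f) ≤ m
  poor v = bound (delete v f) (λ i j → f-sym (punchIn v i) (punchIn v j))
    (diamondFree-on {f = f} (λ {i} {j} → punchIn-injective v i j) free)
  impossible : ¬ M < palette f
  impossible rich = <⇒≱ (toWitness small) (begin
    r * suc M + 2
      ≤⟨ +-monoˡ-≤ 2 (*-monoʳ-≤ r rich) ⟩
    r * palette f + 2
      ≡⟨ cong (λ s → r * palette f + 2 * s) (sum-≟ x) ⟨
    r * palette f + 2 * count (x ≟_)
      ≤⟨ averaging f (x ≟_) (λ { refl → survives }) ⟩
    ∑[ v < 2 + r ] palette (delete v f)
      ≤⟨ sum-mono poor ⟩
    ∑[ v < 2 + r ] m
      ≡⟨ sum-const (2 + r) m ⟩
    (2 + r) * m ∎)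
    where
    open ≤-Reasoning
    persistent : ∃[ x ] ∀ w → Used (delete w f) x
    persistent = persistent-colour {f = f} f-sym free {zero}
      (≤-trans (+-monoˡ-≤ 3 (poor zero)) (≤-trans (toWitness big-gap) rich))
    x : Fin k
    x = proj₁ persistent
    survives : ∀ w → Used (delete w f) x
    survives = proj₂ persistent

-- Exhaustive search

pick : ∀ {A : Set} → List Bool → List A → List A
pick (true  ∷ bs) (x ∷ xs) = x ∷ pick bs xs
pick (false ∷ bs) (x ∷ xs) = pick bs xs
pick _            _        = []

distinct : List ℕ → Bool
distinct []       = true
distinct (x ∷ xs) = all (λ y → not (x ≡ᵇ y)) xs ∧ distinct xs

-- The search assigns classes 0, 1, … to the edges in a fixed order; h lists the classes
-- assigned so far, newest first, and m is the number of classes in use.  A stage holds,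
-- for the edge coloured last, masks selecting from h the diamonds completed by that edge,
-- and a lower bound for m.
Stage : Set
Stage = List (List Bool) × ℕ

closes : Stage → ℕ → List ℕ → Bool
closes (masks , b) m h = (m <ᵇ b) ∨ any (λ mask → distinct (pick mask h)) masks

refuted : List Stage → ℕ → List ℕ → Bool
refuted []       m h = false
refuted (l ∷ ls) m h =
  -- An edge takes an old class or the single new class `m`, so colourings are enumerated only up to
  -- renaming of colours.
  all (λ x → closes l m (x ∷ h) ∨ refuted ls m (x ∷ h)) (upTo m) ∧
  (closes l (suc m) (m ∷ h) ∨ refuted ls (suc m) (m ∷ h))

Pair : ℕ → Set
Pair n = Fin n × Fin n

module _ {n : ℕ} where
  open DecMembership (≡-dec (_≟_ {n}) (_≟_ {n})) using () renaming (_∈?_ to _∈ₑ?_) public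

-- The smaller end comes first, so that each edge has one representative.
edge : ∀ {n} → Fin n → Fin n → Pair n
edge a b with does (a Fin.<? b)
... | true  = a , b
... | false = b , a

diamond : ∀ {n} → Quad n → List (Pair n)
diamond (a , b , c , d) = edge a b ∷ edge a c ∷ edge a d ∷ edge b c ∷ edge b d ∷ []

quads : ∀ n → List (Quad n)
quads n = cartesianProduct vs (cartesianProduct vs (cartesianProduct vs vs))
  where
  vs : List (Fin n)
  vs = allFin n

-- The conditions `a < b` and `c < d` keep one of the four labellings of each diamond.
Fits : ∀ {n} → Pair n → List (Pair n) → Quad n → Set
Fits e es q@(a , b , c , d) =
  e ∈ diamond q × a Fin.< b × c Fin.< d × Unique (a ∷ b ∷ c ∷ d ∷ []) ×
  Unique (diamond q) × All (_∈ e ∷ es) (diamond q)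

fits? : ∀ {n} (e : Pair n) es q → Dec (Fits e es q)
fits? e es q@(a , b , c , d) =
  (e ∈ₑ? diamond q) ×-dec (a Fin.<? b) ×-dec (c Fin.<? d) ×-dec DecUnique.unique? _≟_ (a ∷ b ∷ c ∷ d ∷ []) ×-dec
  DecUnique.unique? (≡-dec _≟_ _≟_) (diamond q) ×-dec All.all? (_∈ₑ? (e ∷ es)) (diamond q)

mask : ∀ {n} → List (Pair n) → List (Pair n) → List Bool
mask es ds = map (λ e → does (e ∈ₑ? ds)) es

levels : ∀ {n} → List (Pair n) → List (Pair n × ℕ) → List Stage
levels     es []              = []
levels {n} es ((e , b) ∷ plan) =
  (map (mask (e ∷ es) ∘ diamond) (filter (fits? e es) (quads n)) , b) ∷ levels (e ∷ es) plan

-- Each row joins one vertex to all later ones, and the last vertices come first. Hence a finished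
-- row completes the edges among the last few vertices, where bounds obtained by deletion apply.
schedule : ∀ n → List (Pair n)
schedule zero    = []
schedule (suc n) =
  map (λ (i , j) → suc i , suc j) (schedule n) ++ map (λ j → zero , suc j) (allFin n)

-- Soundness of the search

all-∈ : ∀ {A : Set} (p : A → Bool) {xs} → all p xs ≡ true → All (λ x → p x ≡ true) xs
all-∈ p {[]}     _ = []
all-∈ p {x ∷ xs} e = let px , pxs = ∧-true e in px ∷ all-∈ p pxs

distinct-sound : ∀ xs → distinct xs ≡ true → Unique xs
distinct-sound []       _ = []
distinct-sound (x ∷ xs) e =
  let fresh , rest = ∧-true e in
  All.map (λ {y} → differ y) (all-∈ (λ y → not (x ≡ᵇ y)) fresh) ∷ distinct-sound xs rest
  where
  differ : ∀ y → not (x ≡ᵇ y) ≡ true → x ≢ y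
  differ y e x≡y with () ← ≡.trans (≡.sym e) (cong not (dec-true (x ℕ.≟ y) x≡y))

pick-map : ∀ {A B : Set} (g : A → B) bs xs → pick bs (map g xs) ≡ map g (pick bs xs)
pick-map g []           xs       = refl
pick-map g (true  ∷ bs) []       = refl
pick-map g (false ∷ bs) []       = refl
pick-map g (true  ∷ bs) (x ∷ xs) = cong (g x ∷_) (pick-map g bs xs)
pick-map g (false ∷ bs) (x ∷ xs) = pick-map g bs xs

pick-⊆ : ∀ {A : Set} bs (xs : List A) {x} → x ∈ pick bs xs → x ∈ xs
pick-⊆ (true  ∷ bs) (x ∷ xs) (here e)  = here e
pick-⊆ (true  ∷ bs) (x ∷ xs) (there p) = there (pick-⊆ bs xs p)
pick-⊆ (false ∷ bs) (x ∷ xs) p         = there (pick-⊆ bs xs p)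

allPairs-map-∈ : ∀ {A : Set} {R S : A → A → Set} {xs} →
  (∀ {x y} → x ∈ xs → y ∈ xs → R x y → S x y) → AllPairs R xs → AllPairs S xs
allPairs-map-∈ R⇒S []        = []
allPairs-map-∈ R⇒S (rs ∷ ps) =
  All.tabulate (λ y∈ → R⇒S (here refl) (there y∈) (All.lookup rs y∈)) ∷
  allPairs-map-∈ (λ x∈ y∈ → R⇒S (there x∈) (there y∈)) ps

allPairs-lookup : ∀ {A : Set} {R : A → A → Set} (R-sym : ∀ {x y} → R x y → R y x) {xs x y} →
  AllPairs R xs → x ∈ xs → y ∈ xs → x ≢ y → R x y
allPairs-lookup R-sym (rs ∷ ps) (here refl) (here refl) x≢y = contradiction refl x≢y
allPairs-lookup R-sym (rs ∷ ps) (here refl) (there y∈)  x≢y = All.lookup rs y∈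
allPairs-lookup R-sym (rs ∷ ps) (there x∈)  (here refl) x≢y = R-sym (All.lookup rs x∈)
allPairs-lookup R-sym (rs ∷ ps) (there x∈)  (there y∈)  x≢y = allPairs-lookup R-sym ps x∈ y∈ x≢y

mask-∈ : ∀ {n} ds (z : List (Pair n × ℕ)) {e} → e ∈ ds → e ∈ map proj₁ z →
  ∃[ x ] (e , x) ∈ pick (mask (map proj₁ z) ds) z
mask-∈ ds ((e , x) ∷ z) e∈ds (here refl) with e ∈ₑ? ds
... | yes _    = x , here refl
... | no  e∉ds = contradiction e∈ds e∉ds
mask-∈ ds ((e′ , _) ∷ z) e∈ds (there e∈z) with does (e′ ∈ₑ? ds) | mask-∈ ds z e∈ds e∈z
... | true  | x , found = x , there found
... | false | x , found = x , found

any-mask : ∀ {n} {es h} (qs : List (Quad n)) {P : Quad n → Set} → All P qs →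
  any (λ bs → distinct (pick bs h)) (map (mask es ∘ diamond) qs) ≡ true →
  ∃[ q ] (P q × distinct (pick (mask es (diamond q)) h) ≡ true)
any-mask (q ∷ qs) (pq ∷ pqs) e with ∨-true e
... | inj₁ found = q , pq , found
... | inj₂ later = any-mask qs pqs later

module _ {n k : ℕ} {f : Shading n k} (f-sym : Symmetric f) where

  shade : Pair n → Fin k
  shade (a , b) = f a b

  shade-edge : ∀ a b → shade (edge a b) ≡ f a b
  shade-edge a b with does (a Fin.<? b)
  ... | true  = refl
  ... | false = f-sym b a

  -- At least b colours occur on es.
  Needs : List (Pair n) → ℕ → Set
  Needs es b = ∀ l → All ((_∈ l) ∘ shade) es → b ≤ length l

  needs-pred : ∀ {e es b} → Needs (e ∷ es) (suc b) → Needs es b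
  needs-pred {e} needs l covered =
    ≤-pred (needs (shade e ∷ l) (here refl ∷ All.map there covered))

  -- The decided condition says that `es` contains every edge within the image of `ι`; a list
  -- covering `es` then covers the palette there.
  needs-palette : ∀ {m es b} (ι : Fin m → Fin n) →
    {True (all? λ i → all? λ j → ¬? (i ≟ j) →-dec (edge (ι i) (ι j) ∈ₑ? es))} →
    b ≤ palette (f on ι) → Needs es b
  needs-palette ι {complete} b≤ l covered = ≤-trans b≤ (palette-cover (f on ι) l
    λ { x (i , j , i≢j , refl) →
        subst (_∈ l) (shade-edge (ι i) (ι j)) (All.lookup covered (toWitness complete i j i≢j)) })

  -- z lists the edges coloured so far, each with the class given to it by the search.
  record Coherent (z : List (Pair n × ℕ)) (m : ℕ) : Set where
    field
      bounded  : All ((_< m) ∘ proj₂) z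
      faithful : ∀ {p q} → p ∈ z → q ∈ z → shade (proj₁ p) ≡ shade (proj₁ q) → proj₂ p ≡ proj₂ q
      seen     : List (Fin k)
      size     : length seen ≡ m
      covers   : All ((_∈ seen) ∘ shade ∘ proj₁) z
  open Coherent

  reuse : ∀ {z m e p} → Coherent z m → p ∈ z → shade e ≡ shade (proj₁ p) →
    Coherent ((e , proj₂ p) ∷ z) m
  reuse {z} {e = e} {p} coh p∈z same = record
    { bounded  = All.lookup (bounded coh) p∈z ∷ bounded coh
    ; faithful = faithful′
    ; seen     = seen coh
    ; size     = size coh
    ; covers   = subst (_∈ seen coh) (≡.sym same) (All.lookup (covers coh) p∈z) ∷ covers coh
    }
    where
    faithful′ : ∀ {q r} → q ∈ (e , proj₂ p) ∷ z → r ∈ (e , proj₂ p) ∷ z →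
      shade (proj₁ q) ≡ shade (proj₁ r) → proj₂ q ≡ proj₂ r
    faithful′ (here refl) (here refl) _  = refl
    faithful′ (here refl) (there r∈)  eq = faithful coh p∈z r∈ (≡.trans (≡.sym same) eq)
    faithful′ (there q∈)  (here refl) eq = faithful coh q∈ p∈z (≡.trans eq same)
    faithful′ (there q∈)  (there r∈)  eq = faithful coh q∈ r∈ eq

  extend : ∀ {z m e} → Coherent z m → (∀ {p} → p ∈ z → shade e ≢ shade (proj₁ p)) →
    Coherent ((e , m) ∷ z) (suc m)
  extend {z} {m} {e} coh new = record
    { bounded  = n<1+n m ∷ All.map m<n⇒m<1+n (bounded coh)
    ; faithful = faithful′
    ; seen     = shade e ∷ seen coh
    ; size     = cong suc (size coh)
    ; covers   = here refl ∷ All.map there (covers coh)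
    }
    where
    faithful′ : ∀ {q r} → q ∈ (e , m) ∷ z → r ∈ (e , m) ∷ z →
      shade (proj₁ q) ≡ shade (proj₁ r) → proj₂ q ≡ proj₂ r
    faithful′ (here refl) (here refl) _  = refl
    faithful′ (here refl) (there r∈)  eq = contradiction eq (new r∈)
    faithful′ (there q∈)  (here refl) eq = contradiction (≡.sym eq) (new q∈)
    faithful′ (there q∈)  (there r∈)  eq = faithful coh q∈ r∈ eq

  -- By `faithful`, edges in distinct classes have distinct colours, so such a mask would exhibit a
  -- rainbow diamond of `f` itself.
  no-rainbow-mask : DiamondFree f → ∀ {p z m} (let z′ = p ∷ z) → Coherent z′ m →
    ∀ {q} → Fits (proj₁ p) (map proj₁ z) q →
    ¬ distinct (pick (mask (map proj₁ z′) (diamond q)) (map proj₂ z′)) ≡ true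
  no-rainbow-mask free {p} {z₀} coh {q@(a , b , c , d)} (_ , _ , _ , vertices , edges , inside) e =
    free q (vertices , colours)
    where
    z : List (Pair n × ℕ)
    z = p ∷ z₀

    bs : List Bool
    bs = mask (map proj₁ z) (diamond q)

    picked : List (Pair n × ℕ)
    picked = pick bs z

    classes-differ : AllPairs (λ p r → proj₂ p ≢ proj₂ r) picked
    classes-differ = AllPairsₚ.map⁻
      (subst Unique (pick-map proj₂ bs z) (distinct-sound _ e))

    shades-differ : AllPairs (λ p r → shade (proj₁ p) ≢ shade (proj₁ r)) picked
    shades-differ = allPairs-map-∈
      (λ p∈ r∈ differ → differ ∘ faithful coh (pick-⊆ bs z p∈) (pick-⊆ bs z r∈)) classes-differ

    diamond-differ : AllPairs (λ e e′ → shade e ≢ shade e′) (diamond q)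
    diamond-differ = allPairs-map-∈ (λ e∈ e′∈ e≢e′ →
        allPairs-lookup (_∘ ≡.sym) shades-differ
          (proj₂ (mask-∈ (diamond q) z e∈ (All.lookup inside e∈)))
          (proj₂ (mask-∈ (diamond q) z e′∈ (All.lookup inside e′∈)))
          (e≢e′ ∘ cong proj₁))
      edges

    colours : Unique (f a b ∷ f a c ∷ f a d ∷ f b c ∷ f b d ∷ [])
    colours = subst Unique
      (cong₂ _∷_ (shade-edge a b) (cong₂ _∷_ (shade-edge a c) (cong₂ _∷_ (shade-edge a d)
        (cong₂ _∷_ (shade-edge b c) (cong₂ _∷_ (shade-edge b d) refl)))))
      (AllPairsₚ.map⁺ diamond-differ)

  Plausible : List (Pair n) → List (Pair n × ℕ) → Set
  Plausible es []               = ⊤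
  Plausible es ((e , b) ∷ plan) = Needs (e ∷ es) b × Plausible (e ∷ es) plan

  module _ (free : DiamondFree f) where

    -- If `m` is too small, the list `seen` of length `m` contradicts `Needs`; if a mask is rainbow,
    -- `f` is not diamond-free.
    not-closed : ∀ {z m e x b} (let es = map proj₁ z) →
      Coherent ((e , x) ∷ z) m → Needs (e ∷ es) b →
      ¬ closes (map (mask (e ∷ es) ∘ diamond) (filter (fits? e es) (quads n)) , b) m (x ∷ map proj₂ z) ≡ true
    not-closed {z} {m} {e} {x} {b} coh needs closed with ∨-true {m <ᵇ b} closed
    ... | inj₁ few = <⇒≱ (<ᵇ⇒< m b (subst T (≡.sym few) tt))
      (subst (b ≤_) (size coh) (needs (seen coh) (Allₚ.map⁺ {f = proj₁} (covers coh))))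
    ... | inj₂ hit =
      let q , fits , rainbow = any-mask {es = e ∷ map proj₁ z} _
                                 (Allₚ.all-filter (fits? e (map proj₁ z)) (quads n)) hit
      in no-rainbow-mask free coh {q} fits rainbow

    -- The shading `f` traces one branch of the search: an edge of a colour seen before takes the
    -- class of that colour, any other edge opens class `m`. No closing test can succeed along this
    -- branch.
    refuted-sound : ∀ plan {z m} → Coherent z m → Plausible (map proj₁ z) plan →
      ¬ refuted (levels (map proj₁ z) plan) m (map proj₂ z) ≡ true
    refuted-sound ((e , b) ∷ plan) {z} {m} coh (needs , plausible) eq
      with Any.any? (λ p → shade e ≟ shade (proj₁ p)) z
    ... | yes old =
      let p , p∈z , same = find old
          coh′ = reuse {e = e} coh p∈z same
      in [ not-closed coh′ needs , refuted-sound plan coh′ plausible ]′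
           (∨-true (All.lookup (all-∈ _ {upTo m} (proj₁ (∧-true eq)))
                               (∈-upTo⁺ (All.lookup (bounded coh) p∈z))))
    ... | no new =
      let coh′ = extend {e = e} coh (λ p∈z same → new (lose p∈z same))
      in [ not-closed coh′ needs , refuted-sound plan coh′ plausible ]′
           (∨-true (proj₂ (∧-true {all _ (upTo m)} eq)))

    search : ∀ plan → Plausible [] plan → ¬ refuted (levels [] plan) 0 [] ≡ true
    search plan = refuted-sound plan record
      { bounded = [] ; faithful = λ () ; seen = [] ; size = refl ; covers = [] }

-- Palette bounds for four to ten vertices

-- Each new edge brings at most one new colour, so the number of colours required at the
-- end of a row of the schedule bounds the number required earlier in the row.
plan₄ : List (Pair 4 × ℕ)
plan₄ = zip (schedule 4) (0 ∷ 1 ∷ 2 ∷ 3 ∷ 4 ∷ 5 ∷ [])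

plan₆ : List (Pair 6 × ℕ)
plan₆ = zip (schedule 6) (0 ∷ 0 ∷ 1 ∷ 2 ∷ 3 ∷ 4 ∷ 3 ∷ 4 ∷ 5 ∷ 6 ∷ 4 ∷ 5 ∷ 6 ∷ 7 ∷ 8 ∷ [])

bound-4 : Bound 4 4
bound-4 f f-sym free = ≮⇒≥ λ rich →
  let need = needs-palette f-sym id rich
      pred = λ {e es b} → needs-pred f-sym {e} {es} {b}
      n₄ = pred need
      n₃ = pred n₄
      n₂ = pred n₃
      n₁ = pred n₂
  -- The final `refl` runs the search by evaluation.
  in search f-sym free plan₄ ((λ _ _ → z≤n) , n₁ , n₂ , n₃ , n₄ , need , tt) refl

-- The rows of `plan₆` end after 6, 10 and 15 edges, where the hypotheses require 4, 6 and 8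
-- colours; the subscripts below count edges.
ordered-search : ∀ {k} (f : Shading 6 k) → Symmetric f → DiamondFree f →
  8 ≤ palette f → 6 ≤ palette (f on suc) → ¬ 4 ≤ palette (f on (λ i → suc (suc i)))
ordered-search f f-sym free rich₆ rich₅ rich₄ =
  let pred = λ {e es b} → needs-pred f-sym {e} {es} {b}
      a₆ = needs-palette f-sym (λ i → suc (suc i)) rich₄
      a₅ = pred a₆
      a₄ = pred a₅
      a₃ = pred a₄
      b₁₀ = needs-palette f-sym suc rich₅
      b₉ = pred b₁₀
      b₈ = pred b₉
      b₇ = pred b₈
      c₁₅ = needs-palette f-sym id rich₆
      c₁₄ = pred c₁₅
      c₁₃ = pred c₁₄
      c₁₂ = pred c₁₃
      c₁₁ = pred c₁₂
  in search f-sym free plan₆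
       ((λ _ _ → z≤n) , (λ _ _ → z≤n) , a₃ , a₄ , a₅ , a₆ , b₇ , b₈ , b₉ , b₁₀ ,
        c₁₁ , c₁₂ , c₁₃ , c₁₄ , c₁₅ , tt) refl

-- Here `bound-step` fails: passing from 8 colours to at most 6 guarantees the loss of only two.
bound-6 : Bound 6 7
bound-6 f f-sym free = ≮⇒≥ λ rich →
  -- The two averagings rest on `6 * 5 < 4 * 8` and `5 * 3 < 3 * 6`.
  let v , rich₅ = rich-deletion f 5 (≤-trans (m≤m+n 31 1) (*-monoʳ-≤ 4 rich))
      w , rich₄ = rich-deletion (delete v f) 3 (≤-trans (m≤m+n 16 2) (*-monoʳ-≤ 3 rich₅))
      -- In the new order `v` comes first and `w` second, so dropping initial vertices deletes `v`
      -- and then `w`.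
      π₅ = Perm.insert zero w Perm.id
      π = Perm.insert zero v π₅
      f′ = f on (π ⟨$⟩ʳ_)
  in ordered-search f′ (λ i j → f-sym (π ⟨$⟩ʳ i) (π ⟨$⟩ʳ j))
       (diamondFree-on {f = f} {ι = π ⟨$⟩ʳ_} (Injection.injective (↔⇒↣ π)) free)
       (≤-trans rich (palette-permute f π))
       (≤-trans rich₅ (palette-permute (delete v f) π₅))
       rich₄

bound-5 : Bound 5 6
bound-5 = bound-step bound-4

bound-7 : Bound 7 9
bound-7 = bound-step bound-6

bound-8 : Bound 8 11
bound-8 = bound-step bound-7

-- The margin is one, `9 * 11 = 99` against `7 * 14 + 2 = 100`, so the persistent colour is
-- decisive.
bound-9 : Bound 9 13
bound-9 = bound-step bound-8

bound-10 : Bound 10 16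
bound-10 = bound-step bound-9

-- The extremal and rainbow numbers combined

module _ {n : ℕ} (n≤10 : n ≤ 10) where

  -- For each concrete `n`, evaluation settles `size` and `onto`. The colouring with `ext n + 1`
  -- colours then rules out every smaller threshold at once.
  assemble : edgeCount (initial n≤10) ≡ ext n → True (colour-onto? n≤10) → Bound n (ext n + 1) →
    Σ ℕ (λ e → IsExtC3C4 n e × IsRbDiamond n (e + 2))
  assemble size onto bound =
    ext n ,
    ((initial n≤10 , initial-noC3 n≤10 , initial-noC4 n≤10 , size) , edgeCount-≤) ,
    forces , sharp
    where
    forces : Forces n (ext n + 2)
    forces k many C with any? (λ a → any? λ b → any? λ c → any? λ d → rainbow? (col C) (a , b , c , d))
    ... | yes (a , b , c , d
              , (a≢b ∷ a≢c ∷ a≢d ∷ []) ∷ (b≢c ∷ b≢d ∷ []) ∷ (c≢d ∷ []) ∷ [] ∷ []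
              , (p ∷ q ∷ r ∷ s ∷ []) ∷ (t ∷ u ∷ v ∷ []) ∷ (w ∷ x ∷ []) ∷ (y ∷ []) ∷ [] ∷ []) =
      a , b , c , d , a≢b , a≢c , a≢d , b≢c , b≢d , c≢d , p , q , r , s , t , u , v , w , x , y
    ... | no none = contradiction
      (≤-trans many (≤-trans (palette-onto (col C) (Colouring.onto C))
        (bound (col C) (csym C) λ (a , b , c , d) rainbow → none (a , b , c , d , rainbow))))
      (<⇒≱ (+-monoʳ-< (ext n) (n<1+n 1)))
    sharp : ∀ m → m < ext n + 2 → ¬ Forces n m
    sharp m m< forced = colouring-noRainbow n≤10 (toWitness onto)
      (forced (suc (ext n)) (≤-pred (≤-trans m< (≤-reflexive (+-comm (ext n) 2))))
        (colouring n≤10 (toWitness onto)))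

theorem10 : ∀ (n : ℕ) → 4 ≤ n → n ≤ 10 →
    Σ ℕ (λ e → IsExtC3C4 n e × IsRbDiamond n (e + 2))
theorem10 0 () _
theorem10 1 (s≤s ()) _
theorem10 2 (s≤s (s≤s ())) _
theorem10 3 (s≤s (s≤s (s≤s ()))) _
theorem10 4  _ n≤10 = assemble n≤10 refl _ bound-4
theorem10 5  _ n≤10 = assemble n≤10 refl _ bound-5
theorem10 6  _ n≤10 = assemble n≤10 refl _ bound-6
theorem10 7  _ n≤10 = assemble n≤10 refl _ bound-7
theorem10 8  _ n≤10 = assemble n≤10 refl _ bound-8
theorem10 9  _ n≤10 = assemble n≤10 refl _ bound-9
theorem10 10 _ n≤10 = assemble n≤10 refl _ bound-10
theorem10 (suc (suc (suc (suc (suc (suc (suc (suc (suc (suc (suc n))))))))))) _ n≤10 =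
  contradiction n≤10 (<⇒≱ (m≤m+n 11 n))
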